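{- Given a Robinson space $(X,d)$ with $|X|=n$, a point $p\in X$, and a $p$-proximity order on $X\setminus\{p\}$, the algorithm sortByBipartition (described in full in the context) returns $X$ sorted along a compatible order in $O(n^2)$ time.
   Context: Let $X$ be a finite set. A dissimilarity on $X$ is a symmetric function $d:X\times X\to[0,\infty)$ with $d(x,x)=0$. "Order" means total order. An order $<$ on $X$ is compatible with $d$ if $x<y<z$ implies $d(x,z)\ge\max\{d(x,y),d(y,z)\}$; $(X,d)$ is a Robinson space if it admits a compatible order. For a compatible order $<$ and $p\in X$, a $p$-proximity order for $<$ is a total order $\prec$ on $X$, with minimum $p$, such that (PO1) for all distinct $x,y\in X$, $x\prec y$ implies $d(p,x)\le d(p,y)$; (PO2) for all distinct $x,y\in X\setminus\{p\}$, $x\prec y$ implies that either $y<p$ and $y<x$, or $y>p$ and $y>x$. A $p$-proximity order is a $p$-proximity order for some compatible order $<$ (which is not given to the algorithm); its restriction to $X\setminus\{p\}$ is what is given. Lists: $[\,]$ is the empty list, $x\cdot L$ is $L$ with $x$ put in front (cost $O(1)$), $L\mathbin{+\!\!+}L'$ is concatenation (cost linear in the length of $L$), and reverse has linear cost. Reading or comparing distances costs $O(1)$. Algorithm sortByBipartition$(p,X)$. Input: a Robinson space $(X,d)$ ($d$ implicit), a point $p\in X$, and $X\setminus\{p\}$ as a list in increasing $p$-proximity order $\prec$. (1) Let $L=[\,]$, $R=[\,]$, $Undecided=$ reverse$(X\setminus\{p\})$. (2) For each $q\in X\setminus\{p\}$ in decreasing order of $\prec$: (2a) if $q\in Undecided$,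 choose arbitrarily either $R\gets q\cdot R$ or $L\gets q\cdot L$, and remove $q$ from $Undecided$; (2b) let $Skipped=[\,]$; (2c) for each $x\in Undecided$ from first to last: if $d(x,q)=d(p,q)$, then $Skipped\gets x\cdot Skipped$; otherwise, if ($d(x,q)<d(p,q)$ and $q\in L$) or ($d(x,q)>d(p,q)$ and $q\in R$), then $L\gets x\cdot L$ and $R\gets Skipped\mathbin{+\!\!+}R$, else $R\gets x\cdot R$ and $L\gets Skipped\mathbin{+\!\!+}L$; in both of these last two cases then $Skipped\gets[\,]$; (2d) $Undecided\gets$ reverse$(Skipped)$. (3) Return reverse$(L)\mathbin{+\!\!+}[p]\mathbin{+\!\!+}R$. -}

module Defs where

open import Algebra.Construct.NaturalChoice.Max as Max using ()
open import Data.Bool.Base using (Bool; _∧_; _∨_; if_then_else_)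
open import Data.Fin.Base using (Fin)
open import Data.Fin.Properties as Fin using ()
open import Data.List.Base using (List; []; _∷_; [_]; _++_; reverse; length; filter)
open import Data.List.Membership.DecPropositional as DecMembership using ()
open import Data.List.Membership.Propositional using (_∈_)
open import Data.List.Relation.Unary.AllPairs using (AllPairs)
open import Data.Nat.Base using (ℕ; suc; _+_)
open import Data.Product.Base using (Σ; _×_; _,_)
open import Data.Sum.Base using (_⊎_)
open import Function.Bundles using (_↔_; _⇔_)
open import Function.Properties.Inverse using (↔⇒↣)
open import Level as Level using (0ℓ)
open import Relation.Binary.Bundles using (DecTotalOrder; StrictTotalOrder)
open import Relation.Binary.Core using (Rel)
open import Relation.Binary.Definitions using (DecidableEquality)
open import Relation.Binary.Properties.DecTotalOrder as DTOProperties using ()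
open import Relation.Binary.PropositionalEquality.Core using (_≡_; _≢_)
open import Relation.Binary.Structures using (IsStrictTotalOrder)
open import Relation.Nullary.Decidable using (does; ¬?; via-injection)

finite⇒≟ : ∀ {a} {X : Set a} {n : ℕ} → X ↔ Fin n → DecidableEquality X
finite⇒≟ X↔Fin = via-injection (↔⇒↣ X↔Fin) Fin._≟_

------------------------------------------------------------------------
-- Robinson spaces and proximity orders

-- Distances live in any decidable total order D with a distinguished
-- element 0#; the real line with its usual order and zero is the
-- intended instance.  No arithmetic on distances is ever used.
--
-- An order on X is represented by its strict part.

module Robinson
  {c ℓ₁ ℓ₂} (D : DecTotalOrder c ℓ₁ ℓ₂) (0# : DecTotalOrder.Carrier D)
  {a} {X : Set a} (d : X → X → DecTotalOrder.Carrier D)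
  where

  open DecTotalOrder D using (_≈_; _≤_; totalOrder)
  open Max totalOrder using (_⊔_)

  record IsDissimilarity : Set (a Level.⊔ ℓ₁ Level.⊔ ℓ₂) where
    field
      nonneg    : ∀ x y → 0# ≤ d x y
      symmetric : ∀ x y → d x y ≈ d y x
      diagonal  : ∀ x → d x x ≈ 0#

  record IsCompatibleOrder (_<_ : Rel X 0ℓ) : Set (a Level.⊔ ℓ₂) where
    field
      isStrictTotalOrder : IsStrictTotalOrder _≡_ _<_
      compatible         : ∀ x y z → x < y → y < z → (d x y ⊔ d y z) ≤ d x z

  record IsRobinsonSpace : Set (Level.suc 0ℓ Level.⊔ a Level.⊔ ℓ₁ Level.⊔ ℓ₂) where
    field
      isDissimilarity : IsDissimilarity
      compatibleOrder : Σ (Rel X 0ℓ) λ _<_ → IsCompatibleOrder _<_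

  record IsProximityOrderFor (_<_ : Rel X 0ℓ) (p : X) (_≺_ : Rel X 0ℓ) : Set (a Level.⊔ ℓ₂) where
    field
      isStrictTotalOrder : IsStrictTotalOrder _≡_ _≺_
      minimum            : ∀ x → x ≢ p → p ≺ x
      PO1                : ∀ x y → x ≢ y → x ≺ y → d p x ≤ d p y
      PO2                : ∀ x y → x ≢ p → y ≢ p → x ≢ y → x ≺ y →
                           (y < p × y < x) ⊎ (p < y × x < y)

  IsProximityOrder : X → Rel X 0ℓ → Set (Level.suc 0ℓ Level.⊔ a Level.⊔ ℓ₂)
  IsProximityOrder p _≺_ =
    Σ (Rel X 0ℓ) λ _<_ → IsCompatibleOrder _<_ × IsProximityOrderFor _<_ p _≺_

  -- xs is X ∖ {p} in increasing order; strictness excludes repetitions.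
  ListsAllBut : X → Rel X 0ℓ → List X → Set a
  ListsAllBut p _≺_ xs = AllPairs _≺_ xs × (∀ x → x ∈ xs ⇔ x ≢ p)

  SortedAlongCompatibleOrder : List X → Set (Level.suc 0ℓ Level.⊔ a Level.⊔ ℓ₂)
  SortedAlongCompatibleOrder ys =
    (∀ x → x ∈ ys) ×
    (Σ (Rel X 0ℓ) λ _<_ → IsCompatibleOrder _<_ × AllPairs _<_ ys)

------------------------------------------------------------------------
-- Computations paired with the number of elementary steps they perform

record Timed {a} (A : Set a) : Set a where
  constructor _after_
  field
    value : A
    time  : ℕ

open Timed public

infixl 1 _>>=_ _>>_

return : ∀ {a} {A : Set a} → A → Timed A
return x = x after 0

_>>=_ : ∀ {a b} {A : Set a} {B : Set b} → Timed A → (A → Timed B) → Timed B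
m >>= f = value (f (value m)) after (time m + time (f (value m)))

_>>_ : ∀ {a b} {A : Set a} {B : Set b} → Timed A → Timed B → Timed B
m >> m′ = m >>= λ _ → m′

step : ∀ {a} {A : Set a} → A → Timed A
step x = x after 1

module _ {a} {A : Set a} where

  nil : Timed (List A)
  nil = step []

  cons : A → List A → Timed (List A)
  cons x xs = step (x ∷ xs)

  append : List A → List A → Timed (List A)
  append xs ys = (xs ++ ys) after suc (length xs)

  rev : List A → Timed (List A)
  rev xs = reverse xs after suc (length xs)

  module _ (_≟_ : DecidableEquality A) where

    -- Membership tests and removals are charged a full scan of the list.

    member : A → List A → Timed Bool
    member x xs = does (DecMembership._∈?_ _≟_ x xs) after suc (length xs)

    remove : A → List A → Timed (List A)
    remove x xs = filter (λ y → ¬? (y ≟ x)) xs after suc (length xs)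

------------------------------------------------------------------------
-- The algorithm

data Side : Set where
  left right : Side

module Algorithm
  {c ℓ₁ ℓ₂} (D : DecTotalOrder c ℓ₁ ℓ₂)
  {a} {X : Set a} (_≟_ : DecidableEquality X) (d : X → X → DecTotalOrder.Carrier D)
  where

  open DecTotalOrder D using (Carrier) renaming (_≟_ to _≈?_)
  open StrictTotalOrder (DTOProperties.<-strictTotalOrder D) using (_<?_)

  equal? : Carrier → Carrier → Timed Bool
  equal? r s = step (does (r ≈? s))

  less? : Carrier → Carrier → Timed Bool
  less? r s = step (does (r <? s))

  -- (d(x,q) < d(p,q) and q ∈ L) or (d(x,q) > d(p,q) and q ∈ R)
  goesLeft : (p q x : X) (L R : List X) → Timed Bool
  goesLeft p q x L R = do
    closer  ← less? (d x q) (d p q)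
    q∈L     ← member _≟_ q L
    farther ← less? (d p q) (d x q)
    q∈R     ← member _≟_ q R
    step ((closer ∧ q∈L) ∨ (farther ∧ q∈R))

  -- The inner loop; the fourth list is Undecided, and the result is the
  -- final (L , R , Skipped).
  scan : (p q : X) (L R Skipped : List X) → List X → Timed (List X × List X × List X)
  scan p q L R Skipped []      = step (L , R , Skipped)
  scan p q L R Skipped (x ∷ U) = do
    same ← equal? (d x q) (d p q)
    if same
      then (do
        Skipped′ ← cons x Skipped
        scan p q L R Skipped′ U)
      else (do
        toLeft ← goesLeft p q x L R
        if toLeft
          then (do
            L′       ← cons x L
            R′       ← append Skipped R
            Skipped′ ← nil
            scan p q L′ R′ Skipped′ U)
          else (do
            R′       ← cons x R
            L′       ← append Skipped L
            Skipped′ ← nil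
            scan p q L′ R′ Skipped′ U))

  place : Side → X → (L R : List X) → Timed (List X × List X)
  place left  q L R = do
    L′ ← cons q L
    return (L′ , R)
  place right q L R = do
    R′ ← cons q R
    return (L , R′)

  -- `choose q` is the arbitrary choice made for q.  Each q is visited only
  -- once, so on a given input every run of the nondeterministic algorithm
  -- arises from such a function.
  decide : (choose : X → Side) (q : X) (L R Undecided : List X) →
           Timed (List X × List X × List X)
  decide choose q L R Undecided = do
    undecided ← member _≟_ q Undecided
    if undecided
      then (do
        (L′ , R′)  ← place (choose q) q L R
        Undecided′ ← remove _≟_ q Undecided
        return (L′ , R′ , Undecided′))
      else return (L , R , Undecided)

  -- The outer loop; the last list holds the points q still to be visited.
  loop : (choose : X → Side) (p : X) (L R Undecided : List X) → List X →
         Timed (List X × List X)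
  loop choose p L R Undecided []       = step (L , R)
  loop choose p L R Undecided (q ∷ qs) = do
    (L₁ , R₁ , Undecided₁) ← decide choose q L R Undecided
    Skipped₀               ← nil
    (L₂ , R₂ , Skipped)    ← scan p q L₁ R₁ Skipped₀ Undecided₁
    Undecided₂             ← rev Skipped
    loop choose p L₂ R₂ Undecided₂ qs

  sortByBipartition : (choose : X → Side) (p : X) (xs : List X) → Timed (List X)
  sortByBipartition choose p xs = do
    L₀        ← nil
    R₀        ← nil
    Undecided ← rev xs
    qs        ← rev xs
    (L , R)   ← loop choose p L₀ R₀ Undecided qs
    L′        ← rev L
    pR        ← append [ p ] R
    append L′ pR

{-# OPTIONS --safe #-}
module Submission where

open import Algebra.Construct.NaturalChoice.Max as Max using ()
open import Data.Bool.Base using (Bool; true; false; _∧_; if_then_else_)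
open import Data.Bool.Properties using (∧-zeroʳ; ∨-zeroʳ)
open import Data.Fin.Base using (Fin; zero; suc)
open import Data.Fin.Properties using (injective⇒≤)
open import Data.List.Base using (List; []; _∷_; [_]; _++_; _ʳ++_; reverse; length; filter; lookup)
open import Data.List.Membership.DecPropositional as DecMembership using ()
open import Data.List.Membership.Propositional using (_∈_; _∉_)
open import Data.List.Membership.Propositional.Properties using (∈-++⁺ˡ; ∈-++⁺ʳ; ∈-++⁻; ∈-lookup)
open import Data.List.Properties using (++-assoc; ++-identityʳ; filter-all; filter-notAll; filter-reject; length-++; length-reverse; reverse-involutive; unfold-reverse; ʳ++-defn)
open import Data.List.Relation.Binary.Sublist.Propositional using (_⊆_; _∷_; _∷ʳ_; []; ⊆-refl; minimum)
open import Data.List.Relation.Binary.Sublist.Propositional.Properties as Sublist using (All-resp-⊆)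
open import Data.List.Relation.Unary.All as All using (All; []; _∷_)
open import Data.List.Relation.Unary.All.Properties as All using ()
open import Data.List.Relation.Unary.AllPairs as AllPairs using (AllPairs; []; _∷_)
open import Data.List.Relation.Unary.AllPairs.Properties as AllPairs using ()
open import Data.List.Relation.Unary.Any as Any using (here; there)
open import Data.List.Relation.Unary.Any.Properties using (reverse⁺; reverse⁻)
open import Data.List.Relation.Unary.Unique.Propositional using (Unique)
open import Data.Nat.Base using (ℕ; suc; s≤s; _+_; _*_; _^_; _≤_; _<_)
open import Data.Nat.Properties using (≤-refl; ≤-reflexive; ≤-trans; <⇒≤; module ≤-Reasoning; +-assoc; +-identityʳ; +-mono-≤; +-monoˡ-≤; +-monoʳ-≤; *-monoʳ-≤; ^-monoˡ-≤; m≤m+n; m≤n+m)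
open import Data.Nat.Tactic.RingSolver using (solve-∀)
open import Data.Product.Base using (Σ-syntax; ∃-syntax; _×_; _,_; proj₁; proj₂)
open import Data.Sum.Base using (_⊎_; inj₁; inj₂)
open import Function.Base using (_∘_; flip)
open import Function.Bundles using (_↔_; module Equivalence; module Injection)
open import Function.Definitions using (Injective)
open import Function.Properties.Inverse using (↔⇒↣)
open import Level using (Level; 0ℓ)
open import Relation.Binary.Bundles using (DecTotalOrder; StrictTotalOrder)
open import Relation.Binary.Core using (Rel)
open import Relation.Binary.Definitions using (DecidableEquality; Tri; tri<; tri≈; tri>)
open import Relation.Binary.Properties.DecTotalOrder as DTOProperties using ()
open import Relation.Binary.PropositionalEquality using (_≡_; _≢_; refl; sym; trans; cong; subst; ≢-sym; isEquivalence)
open import Relation.Binary.Structures using (IsStrictTotalOrder)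
open import Relation.Nullary using (Dec; yes; no; does; ¬_; contradiction)
open import Relation.Nullary.Decidable using (dec-true; dec-false; ¬?)
open import Defs

-- A compatible order for which ≺ is a proximity order is determined by the
-- side of p on which each point lies, and a side assignment comes from such
-- an order iff it satisfies a condition on the triples u ≺ v ≺ w that only
-- depends on whether v and w lie on the same side.  If the assignment is right
-- about q and d(x,q) ≠ d(p,q) with x ≺ q, then this condition forces the side
-- of x and puts every skipped k with x ≺ k ≺ q opposite to x.  If q is still
-- undecided when it is visited, then every w with q ≺ w is equidistant from all
-- points ≼ q, and reversing the block of these points keeps the condition,
-- which makes the choice for q arbitrary.
--
-- For the running time, a point left in Undecided costs O(1) per visit, and
-- the O(n) membership tests and concatenations are paid for once per decided
-- point.

private
  variable
    ℓ ρ : Level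
    A : Set ℓ
    xs ys : List A

-- Pairwise relations on lists.

lookup-injective : Unique xs → Injective _≡_ _≡_ (lookup xs)
lookup-injective (_  ∷ _)   {zero}  {zero}  _  = refl
lookup-injective (x≢ ∷ _)   {zero}  {suc j} eq = contradiction eq (All.lookup x≢ (∈-lookup j))
lookup-injective (x≢ ∷ _)   {suc i} {zero}  eq = contradiction (sym eq) (All.lookup x≢ (∈-lookup i))
lookup-injective (_  ∷ xs!) {suc i} {suc j} eq = cong suc (lookup-injective xs! eq)

module _ {R : Rel A ρ} where

  AllPairs-resp-⊆ : xs ⊆ ys → AllPairs R ys → AllPairs R xs
  AllPairs-resp-⊆ []         []         = []
  AllPairs-resp-⊆ (_ ∷ʳ τ)   (_  ∷ rys) = AllPairs-resp-⊆ τ rys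
  AllPairs-resp-⊆ (refl ∷ τ) (ry ∷ rys) = All-resp-⊆ τ ry ∷ AllPairs-resp-⊆ τ rys

  -- The accumulator `ys` is kept general for the induction; the third hypothesis is what lets each
  -- head of `xs` join it.
  AllPairs-ʳ++⁺ : AllPairs R xs → AllPairs (flip R) ys → All (λ x → All (λ y → R y x) ys) xs →
                  AllPairs (flip R) (xs ʳ++ ys)
  AllPairs-ʳ++⁺ []         rys []         = rys
  AllPairs-ʳ++⁺ (rx ∷ rxs) rys (ryx ∷ ryxs) =
    AllPairs-ʳ++⁺ rxs (ryx ∷ rys) (All.zipWith (λ (r , rs) → r ∷ rs) (rx , ryxs))

  AllPairs-reverse⁺ : AllPairs R xs → AllPairs (flip R) (reverse xs)
  AllPairs-reverse⁺ rxs = AllPairs-ʳ++⁺ rxs [] (All.universal (λ _ → []) _)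

-- The two sides of `p`.

opposite : Side → Side
opposite left  = right
opposite right = left

isLeft : Side → Bool
isLeft left  = true
isLeft right = false

_≟ˢ_ : DecidableEquality Side
left  ≟ˢ left  = yes refl
left  ≟ˢ right = no λ ()
right ≟ˢ left  = no λ ()
right ≟ˢ right = yes refl

side-cases : ∀ σ → σ ≡ left ⊎ σ ≡ right
side-cases left  = inj₁ refl
side-cases right = inj₂ refl

opposite-involutive : ∀ σ → opposite (opposite σ) ≡ σ
opposite-involutive left  = refl
opposite-involutive right = refl

opposite-injective : ∀ {σ τ} → opposite σ ≡ opposite τ → σ ≡ τ
opposite-injective {left}  {left}  _ = refl
opposite-injective {right} {right} _ = refl

≢⇒opposite : ∀ {σ τ} → σ ≢ τ → σ ≡ opposite τ
≢⇒opposite {left}  {left}  σ≢τ = contradiction refl σ≢τ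
≢⇒opposite {left}  {right} _   = refl
≢⇒opposite {right} {left}  _   = refl
≢⇒opposite {right} {right} σ≢τ = contradiction refl σ≢τ

σ≢opposite : ∀ {σ} → σ ≢ opposite σ
σ≢opposite {left}  ()
σ≢opposite {right} ()

-- Unfolding equations for the algorithm.

module Unfolding
  {c ℓ₁ ℓ₂} (D : DecTotalOrder c ℓ₁ ℓ₂)
  {a} {X : Set a} (_≟_ : DecidableEquality X) (d : X → X → DecTotalOrder.Carrier D)
  where

  open DecTotalOrder D using () renaming (_≟_ to _≈?_)
  open Algorithm D _≟_ d

  -- The summands are, in order, the charges for `equal?`, `goesLeft`, `cons`, `append` and `nil`,
  -- and the time `t` of the remaining scan.
  moveTime : (p q x : X) (L R K : List X) → ℕ → ℕ
  moveTime p q x L R K t = 1 + (time (goesLeft p q x L R) + (1 + (suc (length K) + (1 + t))))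

  module _ {p q x : X} {L R K U : List X} where

    -- Value and time sit in one equation, so that the correctness proof and the cost proof can both
    -- transport along it.
    scan-skip : does (d x q ≈? d p q) ≡ true →
                let rest = scan p q L R (x ∷ K) U in
                scan p q L R K (x ∷ U) ≡ value rest after (2 + time rest)
    scan-skip same rewrite same = refl

    scan-left : does (d x q ≈? d p q) ≡ false → value (goesLeft p q x L R) ≡ true →
                let rest = scan p q (x ∷ L) (K ++ R) [] U in
                scan p q L R K (x ∷ U) ≡ value rest after moveTime p q x L R K (time rest)
    scan-left same toLeft rewrite same | toLeft = refl

    scan-right : does (d x q ≈? d p q) ≡ false → value (goesLeft p q x L R) ≡ false →
                 let rest = scan p q (K ++ L) (x ∷ R) [] U in
                 scan p q L R K (x ∷ U) ≡ value rest after moveTime p q x L R K (time rest)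
    scan-right same toLeft rewrite same | toLeft = refl

  module _ {choose : X → Side} {q : X} {L R U : List X} where

    decide-∉ : q ∉ U → value (decide choose q L R U) ≡ (L , R , U)
    decide-∉ q∉U rewrite dec-false (DecMembership._∈?_ _≟_ q U) q∉U = refl

    decide-∈ : q ∈ U → let (L₁ , R₁) = value (place (choose q) q L R) in
               value (decide choose q L R U) ≡ (L₁ , R₁ , filter (λ y → ¬? (y ≟ q)) U)
    decide-∈ q∈U rewrite dec-true (DecMembership._∈?_ _≟_ q U) q∈U = refl

module Correctness
  {c ℓ₁ ℓ₂} (D : DecTotalOrder c ℓ₁ ℓ₂) (0# : DecTotalOrder.Carrier D)
  {a} {X : Set a} (_≟_ : DecidableEquality X) (d : X → X → DecTotalOrder.Carrier D)
  (d-sym : ∀ x y → DecTotalOrder._≈_ D (d x y) (d y x))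
  {_≺_ : Rel X 0ℓ} (≺-isStrictTotalOrder : IsStrictTotalOrder _≡_ _≺_)
  (p : X) (p-minimum : ∀ x → x ≢ p → p ≺ x)
  where

  open DecTotalOrder D using (_≈_; totalOrder; antisym; module Eq)
    renaming (_≤_ to _≤ᵈ_; _≟_ to _≈?_; trans to ≤ᵈ-trans; reflexive to ≤ᵈ-reflexive)
  open Max totalOrder using (_⊔_; x≤x⊔y; x≤y⊔x; ⊔-lub)
  open DTOProperties D using (<-strictTotalOrder) renaming (_<_ to _<ᵈ_; <-asym to <ᵈ-asym)
  open StrictTotalOrder <-strictTotalOrder using () renaming (_<?_ to _<ᵈ?_)
  open DecMembership _≟_ using (_∈?_)
  open IsStrictTotalOrder ≺-isStrictTotalOrder using ()
    renaming (trans to ≺-trans; asym to ≺-asym; irrefl to ≺-irrefl; compare to ≺-compare; _<?_ to _≺?_)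
  open Robinson D 0# d
  open Algorithm D _≟_ d
  open Unfolding D _≟_ d

  -- Side assignments and compatible orders.

  ≢p : ∀ {x y} → x ≺ y → y ≢ p
  ≢p {x} x≺p refl with x ≟ p
  ... | yes refl = ≺-irrefl refl x≺p
  ... | no x≢p   = ≺-asym x≺p (p-minimum x x≢p)

  -- The compatibility inequality for a triple with middle point `y`, with the maximum split into
  -- its two bounds.
  Between : X → X → X → Set ℓ₂
  Between x y z = d x y ≤ᵈ d x z × d y z ≤ᵈ d x z

  ≤ᵈ-resp : ∀ {r r′ s s′} → r ≈ r′ → s ≈ s′ → r ≤ᵈ s → r′ ≤ᵈ s′
  ≤ᵈ-resp r≈r′ s≈s′ r≤s = ≤ᵈ-trans (≤ᵈ-reflexive (Eq.sym r≈r′)) (≤ᵈ-trans r≤s (≤ᵈ-reflexive s≈s′))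

  Between-sym : ∀ {x y z} → Between x y z → Between z y x
  Between-sym (xy≤xz , yz≤xz) =
    ≤ᵈ-resp (d-sym _ _) (d-sym _ _) yz≤xz , ≤ᵈ-resp (d-sym _ _) (d-sym _ _) xy≤xz

  -- Two points equidistant from `z` can exchange their places; this is what makes the reversal of a
  -- block harmless.
  Between-swap : ∀ {x y z} → d x z ≈ d y z → Between x y z → Between y x z
  Between-swap xz≈yz (xy≤xz , yz≤xz) =
    ≤ᵈ-resp (d-sym _ _) xz≈yz xy≤xz , ≤ᵈ-reflexive xz≈yz

  compatible⇒Between : ∀ {_<_ : Rel X 0ℓ} → IsCompatibleOrder _<_ →
                       ∀ {x y z} → x < y → y < z → Between x y z
  compatible⇒Between <-compatible x<y y<z =
    ≤ᵈ-trans (x≤x⊔y _ _) xy⊔yz≤xz , ≤ᵈ-trans (x≤y⊔x _ _) xy⊔yz≤xz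
    where xy⊔yz≤xz = IsCompatibleOrder.compatible <-compatible _ _ _ x<y y<z

  -- p is the ≺-minimum, so s p is irrelevant.
  OrderFrom : (X → Side) → Rel X 0ℓ
  OrderFrom s x y = (x ≺ y × s y ≡ right) ⊎ (y ≺ x × s x ≡ left)

  -- In `OrderFrom s` the middle one of `u ≺ v ≺ w` is `v` if `v` and `w` share a side, and `u`
  -- otherwise. The side of `u` never matters, so `u` may be `p`.
  Consistent : (X → Side) → Set (a Level.⊔ ℓ₂)
  Consistent s = ∀ {u v w} → u ≺ v → v ≺ w →
                 (s v ≡ s w → Between u v w) × (s v ≢ s w → Between v u w)

  private
    clash : ∀ {s : X → Side} {x} {b} {B : Set b} → s x ≡ left → s x ≡ right → B
    clash l r with () ← trans (sym l) r

  OrderFrom-isStrictTotalOrder : ∀ s → IsStrictTotalOrder _≡_ (OrderFrom s)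
  OrderFrom-isStrictTotalOrder s = record
    { isStrictPartialOrder = record
      { isEquivalence = isEquivalence
      ; irrefl        = irreflexive
      ; trans         = transitive
      ; <-resp-≈      = subst (OrderFrom s _) , subst (λ x → OrderFrom s x _)
      }
    ; compare = compare
    }
    where
    irreflexive : ∀ {x y} → x ≡ y → ¬ OrderFrom s x y
    irreflexive x≡y (inj₁ (x≺y , _)) = ≺-irrefl x≡y x≺y
    irreflexive x≡y (inj₂ (y≺x , _)) = ≺-irrefl (sym x≡y) y≺x

    transitive : ∀ {x y z} → OrderFrom s x y → OrderFrom s y z → OrderFrom s x z
    transitive (inj₁ (x≺y , _))  (inj₁ (y≺z , zr)) = inj₁ (≺-trans x≺y y≺z , zr)
    transitive (inj₁ (_   , yr)) (inj₂ (_   , yl)) = clash {s} yl yr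
    transitive (inj₂ (y≺x , xl)) (inj₂ (z≺y , _))  = inj₂ (≺-trans z≺y y≺x , xl)
    -- Here `y` is `≺`-below both `x` and `z`. Whichever of these is the larger, its side puts `x`
    -- first.
    transitive {x} {_} {z} (inj₂ (_ , xl)) (inj₁ (_ , zr)) with ≺-compare x z
    ... | tri< x≺z _ _    = inj₁ (x≺z , zr)
    ... | tri≈ _ refl _   = clash {s} xl zr
    ... | tri> _ _ z≺x    = inj₂ (z≺x , xl)

    asymmetric : ∀ {x y} → OrderFrom s x y → ¬ OrderFrom s y x
    asymmetric x<y y<x = irreflexive refl (transitive x<y y<x)

    compare : ∀ x y → Tri (OrderFrom s x y) (x ≡ y) (OrderFrom s y x)
    compare x y with ≺-compare x y
    ... | tri≈ _ refl _ = tri≈ (irreflexive refl) refl (irreflexive refl)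
    ... | tri< x≺y x≢y _ with side-cases (s y)
    ...   | inj₂ eq = tri< (inj₁ (x≺y , eq)) x≢y (asymmetric (inj₁ (x≺y , eq)))
    ...   | inj₁ eq = tri> (asymmetric (inj₂ (x≺y , eq))) x≢y (inj₂ (x≺y , eq))
    compare x y | tri> _ x≢y y≺x with side-cases (s x)
    ...   | inj₂ eq = tri> (asymmetric (inj₁ (y≺x , eq))) x≢y (inj₁ (y≺x , eq))
    ...   | inj₁ eq = tri< (inj₂ (y≺x , eq)) x≢y (asymmetric (inj₂ (y≺x , eq)))

  -- If `x < y < z`, then `y` is not the `≺`-largest, as it would lie on both sides. If it is the
  -- `≺`-middle one, the same-side clause applies; if it is the least, `x` and `z` lie on different
  -- sides and the other clause applies.
  consistent⇒compatible : ∀ {s} → Consistent s → IsCompatibleOrder (OrderFrom s)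
  consistent⇒compatible {s} consistent = record
    { isStrictTotalOrder = OrderFrom-isStrictTotalOrder s
    ; compatible         = λ x y z x<y y<z → let xy≤xz , yz≤xz = between x<y y<z in ⊔-lub xy≤xz yz≤xz
    }
    where
    between : ∀ {x y z} → OrderFrom s x y → OrderFrom s y z → Between x y z
    between (inj₁ (x≺y , yr)) (inj₁ (y≺z , zr)) = proj₁ (consistent x≺y y≺z) (trans yr (sym zr))
    between (inj₁ (_   , yr)) (inj₂ (_   , yl)) = clash {s} yl yr
    between (inj₂ (y≺x , xl)) (inj₂ (z≺y , yl)) =
      Between-sym (proj₁ (consistent z≺y y≺x) (trans yl (sym xl)))
    between {x} {_} {z} (inj₂ (y≺x , xl)) (inj₁ (y≺z , zr)) with ≺-compare x z
    ... | tri< x≺z _ _  = proj₂ (consistent y≺x x≺z) λ eq → clash {s} xl (trans eq zr)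
    ... | tri≈ _ refl _ = clash {s} xl zr
    ... | tri> _ _ z≺x  = Between-sym (proj₂ (consistent y≺z z≺x) λ eq → clash {s} (trans eq xl) zr)

  -- The assignment reads off the side of `p` in the given order. By PO2 the `≺`-larger of two
  -- points lies further out on its own side, so the order of a triple under `<` follows from the
  -- sides of its two larger points.
  proximity⇒consistent : ∀ {_<_} → IsCompatibleOrder _<_ → IsProximityOrderFor _<_ p _≺_ →
                         Σ[ s ∈ (X → Side) ] Consistent s
  proximity⇒consistent {_<_} <-compatible ≺-proximity = s , consistent
    where
    open IsProximityOrderFor ≺-proximity using (PO2)
    open IsStrictTotalOrder (IsCompatibleOrder.isStrictTotalOrder <-compatible)
      using (_<?_) renaming (compare to <-compare; asym to <-asym)

    s : X → Side
    s x = if does (p <? x) then right else left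

    s-right : ∀ {x} → p < x → s x ≡ right
    s-right {x} p<x rewrite dec-true (p <? x) p<x = refl

    s-left : ∀ {x} → x < p → s x ≡ left
    s-left {x} x<p rewrite dec-false (p <? x) (<-asym x<p) = refl

    -- PO2 speaks of points other than `p`; for `x ≡ p` the alternative is totality of `<`.
    outward : ∀ {x y} → x ≺ y → (y < x × s y ≡ left) ⊎ (x < y × s y ≡ right)
    outward {x} {y} x≺y with x ≟ p
    outward {x} {y} x≺y | yes refl with <-compare y x
    ... | tri< y<p _ _ = inj₁ (y<p , s-left y<p)
    ... | tri≈ _ y≡p _ = contradiction y≡p (≢p x≺y)
    ... | tri> _ _ p<y = inj₂ (p<y , s-right p<y)
    outward {x} {y} x≺y | no x≢p with PO2 x y x≢p (≢p x≺y) (λ x≡y → ≺-irrefl x≡y x≺y) x≺y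
    ... | inj₁ (y<p , y<x) = inj₁ (y<x , s-left y<p)
    ... | inj₂ (p<y , x<y) = inj₂ (x<y , s-right p<y)

    between : ∀ {x y z} → x < y → y < z → Between x y z
    between = compatible⇒Between <-compatible

    consistent : Consistent s
    consistent u≺v v≺w with outward u≺v | outward v≺w | outward (≺-trans u≺v v≺w)
    ... | inj₁ (v<u , vl) | inj₁ (w<v , wl) | _ =
      (λ _ → Between-sym (between w<v v<u)) , contradiction (trans vl (sym wl))
    ... | inj₂ (u<v , vr) | inj₂ (v<w , wr) | _ =
      (λ _ → between u<v v<w) , contradiction (trans vr (sym wr))
    ... | inj₁ (v<u , vl) | inj₂ (_ , wr) | inj₂ (u<w , _) =
      (λ eq → clash {s} vl (trans eq wr)) , λ _ → between v<u u<w
    ... | inj₂ (u<v , vr) | inj₁ (_ , wl) | inj₁ (w<u , _) =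
      (λ eq → clash {s} (trans eq wl) vr) , λ _ → Between-sym (between w<u u<v)
    -- The comparisons of `w` with `v` and with `u` both report the side of `w`, so they cannot
    -- disagree.
    ... | inj₁ _ | inj₂ (_ , wr) | inj₁ (_ , wl) = clash {s} wl wr
    ... | inj₂ _ | inj₁ (_ , wl) | inj₂ (_ , wr) = clash {s} wl wr

  -- Reversing the block of points up to `q`.

  -- In `OrderFrom s` the points not above `q` form an interval around `p`; exchanging their sides
  -- reverses this interval.
  flipUpTo : X → (X → Side) → X → Side
  flipUpTo q s x = if does (q ≺? x) then s x else opposite (s x)

  flipUpTo-above : ∀ {q} s {x} → q ≺ x → flipUpTo q s x ≡ s x
  flipUpTo-above {q} s {x} q≺x rewrite dec-true (q ≺? x) q≺x = refl

  flipUpTo-below : ∀ {q} s {x} → ¬ q ≺ x → flipUpTo q s x ≡ opposite (s x)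
  flipUpTo-below {q} s {x} q⊀x rewrite dec-false (q ≺? x) q⊀x = refl

  -- Whether `v` and `w` share a side changes only if the block contains `v` but not `w`. Then it
  -- contains `u` too, so `u` and `v` are equidistant from `w`, and `Between-swap` turns each clause
  -- into the other.
  flipUpTo-consistent : ∀ {q s} → (∀ {u w} → ¬ q ≺ u → q ≺ w → d u w ≈ d p w) →
                        Consistent s → Consistent (flipUpTo q s)
  flipUpTo-consistent {q} {s} homogeneous consistent {u} {v} {w} u≺v v≺w
    with consistent u≺v v≺w | q ≺? v | q ≺? w
  ... | same , different | yes _   | yes _   = same , different
  ... | _                | yes q≺v | no q⊀w  = contradiction (≺-trans q≺v v≺w) q⊀w
  ... | same , different | no _    | no _    =
      same ∘ opposite-injective , λ sv≢sw → different (sv≢sw ∘ cong opposite)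
  ... | same , different | no q⊀v | yes q≺w =
      (λ eq → Between-swap (Eq.sym uw≈vw) (different λ sv≡sw → σ≢opposite (trans sv≡sw (sym eq)))) ,
      (λ neq → Between-swap uw≈vw (same (sym (≢⇒same neq))))
    where
    uw≈vw : d u w ≈ d v w
    uw≈vw = Eq.trans (homogeneous (λ q≺u → q⊀v (≺-trans q≺u u≺v)) q≺w) (Eq.sym (homogeneous q⊀v q≺w))

    ≢⇒same : opposite (s v) ≢ s w → s w ≡ s v
    ≢⇒same neq = trans (≢⇒opposite (≢-sym neq)) (opposite-involutive (s v))

  -- Any choice for `q` is right for some consistent assignment: a wrong one is corrected by
  -- reversing the block, which leaves the points above `q` alone.
  realise : ∀ {q s} → (∀ {u w} → ¬ q ≺ u → q ≺ w → d u w ≈ d p w) → Consistent s → ∀ σ →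
            Σ[ s′ ∈ (X → Side) ] Consistent s′ × s′ q ≡ σ × (∀ {x} → q ≺ x → s′ x ≡ s x)
  realise {q} {s} homogeneous consistent σ with s q ≟ˢ σ
  ... | yes sq≡σ = s , consistent , sq≡σ , λ _ → refl
  ... | no  sq≢σ = flipUpTo q s , flipUpTo-consistent homogeneous consistent ,
                   trans (flipUpTo-below s (≺-irrefl refl)) (sym (≢⇒opposite (≢-sym sq≢σ))) ,
                   flipUpTo-above s

  -- The invariant on one side of `p`.

  -- L is a list of points already placed on side σ, and M lists the
  -- undecided and skipped points in increasing order.
  record Branch (s : X → Side) (σ : Side) (L M : List X) : Set a where
    field
      chain  : AllPairs _≺_ (p ∷ M ++ L)
      onSide : All (λ x → s x ≡ σ) L
      cover  : ∀ {x} → x ≢ p → s x ≡ σ → x ∈ M ++ L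

    p≺ : ∀ {x} → x ∈ M ++ L → p ≺ x
    p≺ = All.lookup (AllPairs.head chain)

    M≺L : ∀ {m x} → m ∈ M → x ∈ L → m ≺ x
    M≺L m∈M x∈L = go (AllPairs.tail chain) m∈M
      where
      go : ∀ {N m} → AllPairs _≺_ (N ++ L) → m ∈ N → m ≺ _
      go {_ ∷ N} (m≺ ∷ _)   (here refl)  = All.lookup m≺ (∈-++⁺ʳ N x∈L)
      go         (_ ∷ rest) (there m∈N) = go rest m∈N

  open Branch

  -- The common form of all updates: the top segment `N` stops being undecided, and this branch
  -- receives the part `N′` of it that lies on side `σ`. Being a sublist keeps the chain; exhausting
  -- that side keeps `cover`.
  settle : ∀ {s σ L M N N′} → N′ ⊆ N → All (λ x → s x ≡ σ) N′ → (∀ {x} → x ∈ N → s x ≡ σ → x ∈ N′) →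
           Branch s σ L (M ++ N) → Branch s σ (N′ ++ L) M
  settle {s} {σ} {L} {M} {N} {N′} N′⊆N onN′ exhausts branch = record
    { chain  = AllPairs-resp-⊆
        (refl ∷ subst (M ++ N′ ++ L ⊆_) (sym (++-assoc M N L))
          (Sublist.++⁺ (⊆-refl {x = M}) (Sublist.++⁺ N′⊆N ⊆-refl)))
        (chain branch)
    ; onSide = All.++⁺ onN′ (onSide branch)
    ; cover  = cover′
    }
    where
    cover′ : ∀ {x} → x ≢ p → s x ≡ σ → x ∈ M ++ N′ ++ L
    cover′ x≢p sx≡σ with ∈-++⁻ (M ++ N) (cover branch x≢p sx≡σ)
    ... | inj₂ x∈L = ∈-++⁺ʳ M (∈-++⁺ʳ N′ x∈L)
    ... | inj₁ x∈MN with ∈-++⁻ M x∈MN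
    ...   | inj₁ x∈M = ∈-++⁺ˡ x∈M
    ...   | inj₂ x∈N = ∈-++⁺ʳ M (∈-++⁺ˡ (exhausts x∈N sx≡σ))

  -- The inner loop.

  module _ {s} (consistent : Consistent s) where

    -- For `p ≺ x ≺ q`, consistency gives d(x,q) ≤ d(p,q) on equal sides and the reverse inequality
    -- on different sides; both are strict here. The membership tests reveal the side of `q`, which
    -- is no longer in `M`.
    goesLeft-side : ∀ {q x L R M} → Branch s left L M → Branch s right R M →
                    (∀ {m} → m ∈ M → m ≺ q) → x ∈ M → ¬ d x q ≈ d p q →
                    value (goesLeft p q x L R) ≡ isLeft (s x)
    goesLeft-side {q} {x} {L} {R} {M} branchₗ branchᵣ M≺q x∈M xq≉pq = result
      where
      p≺x = p≺ branchₗ (∈-++⁺ˡ x∈M)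
      x≺q = M≺q x∈M

      ∈branch : ∀ {σ K} → Branch s σ K M → s q ≡ σ → does (q ∈? K) ≡ true
      ∈branch branch sq≡σ with ∈-++⁻ M (cover branch (≢p x≺q) sq≡σ)
      ... | inj₁ q∈M = contradiction (M≺q q∈M) (≺-irrefl refl)
      ... | inj₂ q∈K = dec-true (q ∈? _) q∈K

      ∉branch : ∀ {σ K} → Branch s σ K M → s q ≢ σ → does (q ∈? K) ≡ false
      ∉branch branch sq≢σ = dec-false (q ∈? _) λ q∈K → sq≢σ (All.lookup (onSide branch) q∈K)

      closer : s x ≡ s q → d x q <ᵈ d p q
      closer same = proj₂ (proj₁ (consistent p≺x x≺q) same) , xq≉pq

      farther : s x ≢ s q → d p q <ᵈ d x q
      farther different = proj₂ (proj₂ (consistent p≺x x≺q) different) , xq≉pq ∘ Eq.sym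

      result : value (goesLeft p q x L R) ≡ isLeft (s x)
      result with side-cases (s x) | side-cases (s q)
      ... | inj₁ xl | inj₁ ql
        rewrite dec-true (d x q <ᵈ? d p q) (closer (trans xl (sym ql))) | ∈branch branchₗ ql | xl = refl
      -- The first disjunct fails because `q` is not in `L`, the second because `x` is closer to `q`
      -- than `p` is.
      ... | inj₂ xr | inj₂ qr
        rewrite dec-false (d p q <ᵈ? d x q) (<ᵈ-asym (closer (trans xr (sym qr))))
              | ∉branch branchₗ (λ ql → clash {s} ql qr)
              | ∧-zeroʳ (does (d x q <ᵈ? d p q)) | xr = refl
      ... | inj₁ xl | inj₂ qr
        rewrite dec-true (d p q <ᵈ? d x q) (farther λ eq → clash {s} (trans (sym eq) xl) qr)
              | ∈branch branchᵣ qr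
              | ∨-zeroʳ (does (d x q <ᵈ? d p q) ∧ does (q ∈? L)) | xl = refl
      ... | inj₂ xr | inj₁ ql
        rewrite dec-false (d x q <ᵈ? d p q) (<ᵈ-asym (farther λ eq → clash {s} (trans eq ql) xr))
              | ∉branch branchᵣ (λ qr → clash {s} ql qr)
              | ∧-zeroʳ (does (d p q <ᵈ? d x q)) | xr = refl

    -- If `x` and `k` shared a side, d(x,q) would be squeezed between the equal distances d(k,q) and
    -- d(p,q): d(k,q) ≤ d(x,q) ≤ d(p,q) if `q` is on that side too, and d(p,q) ≤ d(x,q) ≤ d(k,q)
    -- otherwise.
    opposite-side : ∀ {q x k} → p ≺ x → x ≺ k → k ≺ q → d k q ≈ d p q → ¬ d x q ≈ d p q → s x ≢ s k
    opposite-side {q} {x} {k} p≺x x≺k k≺q kq≈pq xq≉pq sx≡sk with s k ≟ˢ s q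
    ... | yes sk≡sq = xq≉pq (antisym
      (proj₂ (proj₁ (consistent p≺x (≺-trans x≺k k≺q)) (trans sx≡sk sk≡sq)))
      (≤ᵈ-trans (≤ᵈ-reflexive (Eq.sym kq≈pq)) (proj₂ (proj₁ (consistent x≺k k≺q) sk≡sq))))
    ... | no sk≢sq = xq≉pq (antisym
      (≤ᵈ-trans (proj₂ (proj₂ (consistent x≺k k≺q) sk≢sq)) (≤ᵈ-reflexive kq≈pq))
      (proj₂ (proj₂ (consistent p≺x (≺-trans x≺k k≺q)) (sk≢sq ∘ trans (sym sx≡sk)))))

    -- On its own side `x` is all that `x ∷ K` contributes, the skipped points being opposite to it;
    -- `released` is the other branch, which receives `K`.
    decided : ∀ {σ L M K x} → s x ≡ σ → All (λ k → s k ≢ s x) K →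
              Branch s σ L (M ++ x ∷ K) → Branch s σ (x ∷ L) M
    decided {σ} {L} {M} {K} {x} sx≡σ K-opposite = settle (refl ∷ minimum K) (sx≡σ ∷ []) exhausts
      where
      exhausts : ∀ {y} → y ∈ x ∷ K → s y ≡ σ → y ∈ [ x ]
      exhausts (here y≡x)  _    = here y≡x
      exhausts (there y∈K) sy≡σ = contradiction (trans sy≡σ (sym sx≡σ)) (All.lookup K-opposite y∈K)

    released : ∀ {σ R M K x} → s x ≡ opposite σ → All (λ k → s k ≢ s x) K →
               Branch s σ R (M ++ x ∷ K) → Branch s σ (K ++ R) M
    released {σ} {R} {M} {K} {x} sx≡oppσ K-opposite =
      settle (x ∷ʳ ⊆-refl) (All.map onSide′ K-opposite) exhausts
      where
      onSide′ : ∀ {k} → s k ≢ s x → s k ≡ σ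
      onSide′ sk≢sx = trans (≢⇒opposite sk≢sx) (trans (cong opposite sx≡oppσ) (opposite-involutive σ))

      exhausts : ∀ {y} → y ∈ x ∷ K → s y ≡ σ → y ∈ K
      exhausts (here refl) sy≡σ = contradiction (trans (sym sy≡σ) sx≡oppσ) σ≢opposite
      exhausts (there y∈K) _    = y∈K

    -- The equalities over `K` feed the equidistance condition of `Pending`; the inclusion carries
    -- what is known about the earlier candidates over to those that remain.
    Scanned : X → List X → List X × List X × List X → Set _
    Scanned q M (L , R , K) =
      Branch s left L K × Branch s right R K × All (λ k → d k q ≈ d p q) K × (∀ {x} → x ∈ K → x ∈ M)

    -- `U ʳ++ K` lists all candidates in increasing order, because `U` decreases and `K` increases.
    -- Skipping `x` leaves this list unchanged definitionally; placing `x` settles its top segment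
    -- `x ∷ K` and restarts with nothing skipped.
    scan-correct : ∀ {q} L R K U → Branch s left L (U ʳ++ K) → Branch s right R (U ʳ++ K) →
                   (∀ {m} → m ∈ U ʳ++ K → m ≺ q) → All (λ k → d k q ≈ d p q) K →
                   Scanned q (U ʳ++ K) (value (scan p q L R K U))
    scan-correct L R K [] branchₗ branchᵣ _ K-eq = branchₗ , branchᵣ , K-eq , λ x∈K → x∈K
    scan-correct {q} L R K (x ∷ U) branchₗ branchᵣ M≺q K-eq = by-distance (d x q ≈? d p q)
      where
      M = (x ∷ U) ʳ++ K

      M≡ : M ≡ reverse U ++ x ∷ K
      M≡ = ʳ++-defn U

      reversed∈M : ∀ {m} → m ∈ reverse U → m ∈ M
      reversed∈M m∈ = subst (_ ∈_) (sym M≡) (∈-++⁺ˡ m∈)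

      K∈M : ∀ {m} → m ∈ x ∷ K → m ∈ M
      K∈M m∈ = subst (_ ∈_) (sym M≡) (∈-++⁺ʳ (reverse U) m∈)

      x≺K : All (x ≺_) K
      x≺K = AllPairs.head (AllPairs-resp-⊆ (p ∷ʳ subst (λ N → x ∷ K ⊆ N ++ L) (sym M≡)
              (Sublist.++⁺ʳ L (Sublist.++⁺ˡ (reverse U) ⊆-refl))) (chain branchₗ))

      K-opposite : ¬ d x q ≈ d p q → All (λ k → s k ≢ s x) K
      K-opposite xq≉pq = All.tabulate λ k∈K → ≢-sym (opposite-side (p≺ branchₗ (∈-++⁺ˡ (K∈M (here refl))))
        (All.lookup x≺K k∈K) (M≺q (K∈M (there k∈K))) (All.lookup K-eq k∈K) xq≉pq)

      goesLeft≡ : ¬ d x q ≈ d p q → value (goesLeft p q x L R) ≡ isLeft (s x)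
      goesLeft≡ xq≉pq = goesLeft-side branchₗ branchᵣ M≺q (K∈M (here refl)) xq≉pq

      branchₗ′ = subst (Branch s left L) M≡ branchₗ
      branchᵣ′ = subst (Branch s right R) M≡ branchᵣ

      weaken : ∀ {LRK} → Scanned q (reverse U) LRK → Scanned q M LRK
      weaken (branchₗ′ , branchᵣ′ , K′-eq , K′⊆) = branchₗ′ , branchᵣ′ , K′-eq , reversed∈M ∘ K′⊆

      by-side : ¬ d x q ≈ d p q → s x ≡ left ⊎ s x ≡ right → Scanned q M (value (scan p q L R K (x ∷ U)))
      by-side xq≉pq (inj₁ xl) = subst (Scanned q M ∘ value)
        (sym (scan-left {K = K} {U} (dec-false (d x q ≈? d p q) xq≉pq)
          (trans (goesLeft≡ xq≉pq) (cong isLeft xl))))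
        (weaken (scan-correct (x ∷ L) (K ++ R) [] U
          (decided xl (K-opposite xq≉pq) branchₗ′) (released xl (K-opposite xq≉pq) branchᵣ′)
          (M≺q ∘ reversed∈M) []))
      by-side xq≉pq (inj₂ xr) = subst (Scanned q M ∘ value)
        (sym (scan-right {K = K} {U} (dec-false (d x q ≈? d p q) xq≉pq)
          (trans (goesLeft≡ xq≉pq) (cong isLeft xr))))
        (weaken (scan-correct (K ++ L) (x ∷ R) [] U
          (released xr (K-opposite xq≉pq) branchₗ′) (decided xr (K-opposite xq≉pq) branchᵣ′)
          (M≺q ∘ reversed∈M) []))

      by-distance : Dec (d x q ≈ d p q) → Scanned q M (value (scan p q L R K (x ∷ U)))
      by-distance (yes xq≈pq) = subst (Scanned q M ∘ value)
        (sym (scan-skip {L = L} {R} {K} {U} (dec-true (d x q ≈? d p q) xq≈pq)))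
        (scan-correct L R (x ∷ K) U branchₗ branchᵣ M≺q (xq≈pq ∷ K-eq))
      by-distance (no xq≉pq) = by-side xq≉pq (side-cases (s x))

  -- The outer loop.

  -- qs contains Undecided, and outside of ws the points have been scanned.
  Pending : (X → Side) → (qs ws : List X) → List X × List X × List X → Set _
  Pending s qs ws (L , R , U) =
    Consistent s × Branch s left L (reverse U) × Branch s right R (reverse U) ×
    (∀ {x} → x ∈ U → x ∈ qs) × (∀ {u w} → u ∈ U → w ≢ p → w ∉ ws → d u w ≈ d p w)

  -- The placed points lie above the undecided `q`, where the assignments agree; points not above
  -- `q` are in `M`, whose sides a branch does not fix.
  relabel : ∀ {s s′ σ L M q} → q ∈ M → (∀ {x} → x ≢ p → ¬ q ≺ x → x ∈ M) →
            (∀ {x} → q ≺ x → s′ x ≡ s x) → Branch s σ L M → Branch s′ σ L M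
  relabel {s} {s′} {σ} {L} {M} {q} q∈M upTo agree branch = record
    { chain  = chain branch
    ; onSide = All.tabulate λ x∈L → trans (agree (M≺L branch q∈M x∈L)) (All.lookup (onSide branch) x∈L)
    ; cover  = cover′
    }
    where
    cover′ : ∀ {x} → x ≢ p → s′ x ≡ σ → x ∈ M ++ L
    cover′ {x} x≢p s′x≡σ with q ≺? x
    ... | yes q≺x = cover branch x≢p (trans (sym (agree q≺x)) s′x≡σ)
    ... | no q⊀x  = ∈-++⁺ˡ (upTo x≢p q⊀x)

  within : ∀ {s σ L M q x} → Branch s σ L M → q ∈ M → x ∈ M ++ L → ¬ q ≺ x → x ∈ M
  within {M = M} branch q∈M x∈ q⊀x with ∈-++⁻ M x∈
  ... | inj₁ x∈M = x∈M
  ... | inj₂ x∈L = contradiction (M≺L branch q∈M x∈L) q⊀x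

  -- Placed points lie above all of `M`, so an undecided `q` has no placed point below it. Hence the
  -- block up to `q` inherits the equidistance of the undecided points.
  undecided-upTo : ∀ {s L R M q} → Branch s left L M → Branch s right R M → q ∈ M →
                   ∀ {x} → x ≢ p → ¬ q ≺ x → x ∈ M
  undecided-upTo {s} {M = M} {q} bₗ bᵣ q∈M {x} x≢p q⊀x with side-cases (s x)
  ... | inj₁ xl = within bₗ q∈M (cover bₗ x≢p xl) q⊀x
  ... | inj₂ xr = within bᵣ q∈M (cover bᵣ x≢p xr) q⊀x

  -- A different head of `U` would be above `q` as `U` decreases, yet below `q` as a member of `qs`.
  head-undecided : ∀ {q qs U} → All (_≺ q) qs → AllPairs (flip _≺_) U → (∀ {x} → x ∈ U → x ∈ q ∷ qs) →
                   q ∈ U → ∃[ U′ ] U ≡ q ∷ U′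
  head-undecided _ _ _ (here refl) = _ , refl
  head-undecided qs≺q (≺u ∷ _) U⊆ (there q∈U) with U⊆ (here refl)
  ... | here refl  = _ , refl
  ... | there u∈qs = contradiction (All.lookup ≺u q∈U) (≺-asym (All.lookup qs≺q u∈qs))

  -- `realise` replaces `s` by an assignment that agrees with the choice. The list `ws` still
  -- contains `q`, which is now placed but not yet scanned.
  decide-head : ∀ {s} σ {L R U q qs} → All (_≺ q) qs → AllPairs (flip _≺_) (q ∷ U) →
                Pending s (q ∷ qs) (q ∷ qs) (L , R , q ∷ U) →
                let (L₁ , R₁) = value (place σ q L R) in
                Σ[ s′ ∈ (X → Side) ] Pending s′ qs (q ∷ qs) (L₁ , R₁ , U)
  decide-head {s} σ {L} {R} {U} {q} {qs} qs≺q (U≺q ∷ _) (consistent , bₗ , bᵣ , U⊆ , homogeneous) =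
    relabelled-branches (realise homogeneous-block consistent σ)
    where
    q∈M : q ∈ reverse (q ∷ U)
    q∈M = reverse⁺ {xs = q ∷ U} (here refl)

    upTo : ∀ {x} → x ≢ p → ¬ q ≺ x → x ∈ reverse (q ∷ U)
    upTo = undecided-upTo bₗ bᵣ q∈M

    homogeneous-block : ∀ {u w} → ¬ q ≺ u → q ≺ w → d u w ≈ d p w
    -- A point above `q` is not in `q ∷ qs`, so it has been scanned already.
    homogeneous-block {u} {w} q⊀u q≺w with u ≟ p
    ... | yes refl = Eq.refl
    ... | no u≢p = homogeneous (reverse⁻ (upTo u≢p q⊀u)) (≢p q≺w) λ where
      (here refl)  → ≺-irrefl refl q≺w
      (there w∈qs) → ≺-asym q≺w (All.lookup qs≺q w∈qs)

    U⊆qs : ∀ {x} → x ∈ U → x ∈ qs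
    U⊆qs x∈U with U⊆ (there x∈U)
    ... | here refl  = contradiction (All.lookup U≺q x∈U) (≺-irrefl refl)
    ... | there x∈qs = x∈qs

    relabelled-branches : (Σ[ s′ ∈ (X → Side) ] Consistent s′ × s′ q ≡ σ × (∀ {x} → q ≺ x → s′ x ≡ s x)) →
                          let (L₁ , R₁) = value (place σ q L R) in
                          Σ[ s′ ∈ (X → Side) ] Pending s′ qs (q ∷ qs) (L₁ , R₁ , U)
    relabelled-branches (s′ , consistent′ , s′q≡σ , agree) = s′ , branches σ s′q≡σ
      where
      relabelled : ∀ {σ K} → Branch s σ K (reverse (q ∷ U)) → Branch s′ σ K (reverse U ++ [ q ])
      relabelled branch = subst (Branch s′ _ _) (unfold-reverse q U)
        (relabel q∈M upTo agree branch)

      put : ∀ {σ K} → s′ q ≡ σ → Branch s σ K (reverse (q ∷ U)) → Branch s′ σ (q ∷ K) (reverse U)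
      put s′q≡σ branch = settle ⊆-refl (s′q≡σ ∷ []) (λ x∈ _ → x∈) (relabelled branch)

      leave : ∀ {σ K} → s′ q ≢ σ → Branch s σ K (reverse (q ∷ U)) → Branch s′ σ K (reverse U)
      leave s′q≢σ branch =
        settle (minimum [ q ]) [] (λ { (here refl) s′q≡σ → contradiction s′q≡σ s′q≢σ }) (relabelled branch)

      branches : ∀ σ → s′ q ≡ σ →
                 let (L₁ , R₁) = value (place σ q L R) in Pending s′ qs (q ∷ qs) (L₁ , R₁ , U)
      branches left  ql = consistent′ , put ql bₗ , leave (λ qr → clash {s′} ql qr) bᵣ , U⊆qs , homogeneous ∘ there
      branches right qr = consistent′ , leave (λ ql → clash {s′} ql qr) bₗ , put qr bᵣ , U⊆qs , homogeneous ∘ there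

  decide-correct : ∀ {s choose L R U q qs} → All (_≺ q) qs →
                   Pending s (q ∷ qs) (q ∷ qs) (L , R , U) →
                   Σ[ s′ ∈ (X → Side) ] Pending s′ qs (q ∷ qs) (value (decide choose q L R U))
  decide-correct {s} {choose} {L} {R} {U} {q} {qs} qs≺q pending@(consistent , bₗ , bᵣ , U⊆ , homogeneous) =
    by-membership (q ∈? U)
    where
    U⊆qs : q ∉ U → ∀ {x} → x ∈ U → x ∈ qs
    U⊆qs q∉U x∈U with U⊆ x∈U
    ... | here refl  = contradiction x∈U q∉U
    ... | there x∈qs = x∈qs

    -- The order of `U` is recovered from the chain of the left branch.
    descending : AllPairs (flip _≺_) U
    descending = subst (AllPairs (flip _≺_)) (reverse-involutive U)
      (AllPairs-reverse⁺ (AllPairs-resp-⊆ (Sublist.++⁺ʳ L ⊆-refl) (AllPairs.tail (chain bₗ))))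

    by-membership : Dec (q ∈ U) → Σ[ s′ ∈ (X → Side) ] Pending s′ qs (q ∷ qs) (value (decide choose q L R U))
    by-membership (no q∉U) = s , subst (Pending s qs (q ∷ qs)) (sym (decide-∉ {choose} {q} {L} {R} q∉U))
      (consistent , bₗ , bᵣ , U⊆qs q∉U , homogeneous)
    by-membership (yes q∈U) with head-undecided qs≺q descending U⊆ q∈U
    ... | U′ , refl with s′ , pending′ ← decide-head (choose q) qs≺q descending pending =
      s′ , subst (Pending s′ qs (q ∷ qs)) (sym decided≡) pending′
      where
      removed : filter (λ y → ¬? (y ≟ q)) (q ∷ U′) ≡ U′
      removed = trans (filter-reject (λ y → ¬? (y ≟ q)) (λ q≢q → q≢q refl))
        (filter-all (λ y → ¬? (y ≟ q)) (All.map (λ u≺q u≡q → ≺-irrefl u≡q u≺q) (AllPairs.head descending)))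

      placed = value (place (choose q) q L R)

      decided≡ : value (decide choose q L R (q ∷ U′)) ≡ (proj₁ placed , proj₂ placed , U′)
      decided≡ = trans (decide-∈ {choose} {q} {L} {R} (here refl))
        (cong (λ V → proj₁ placed , proj₂ placed , V) removed)

  -- Whatever survives the scan is as far from `q` as `p` is, so `q` can leave `ws`.
  scan-pending : ∀ {s q qs} L R U → All (_≺ q) qs → Pending s qs (q ∷ qs) (L , R , U) →
                 let (L′ , R′ , K) = value (scan p q L R [] U) in
                 Pending s qs qs (L′ , R′ , reverse K)
  scan-pending {s} {q} {qs} L R U qs≺q (consistent , bₗ , bᵣ , U⊆ , homogeneous)
    with bₗ′ , bᵣ′ , K-eq , K⊆ ← scan-correct consistent L R [] U bₗ bᵣ (All.lookup qs≺q ∘ U⊆ ∘ reverse⁻) []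
    = consistent ,
      subst (Branch s left _) (sym (reverse-involutive _)) bₗ′ ,
      subst (Branch s right _) (sym (reverse-involutive _)) bᵣ′ ,
      U⊆ ∘ reverse⁻ ∘ K⊆ ∘ reverse⁻ ,
      homogeneous′
    where
    K = proj₂ (proj₂ (value (scan p q L R [] U)))

    homogeneous′ : ∀ {u w} → u ∈ reverse K → w ≢ p → w ∉ qs → d u w ≈ d p w
    homogeneous′ {u} {w} u∈ w≢p w∉qs with w ≟ q
    ... | yes refl = All.lookup K-eq (reverse⁻ u∈)
    ... | no w≢q = homogeneous (reverse⁻ (K⊆ (reverse⁻ u∈))) w≢p λ where
      (here w≡q)   → w≢q w≡q
      (there w∈qs) → w∉qs w∈qs

  loop-correct : ∀ {s choose} L R U qs → AllPairs (flip _≺_) qs → Pending s qs qs (L , R , U) →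
                 let (L′ , R′) = value (loop choose p L R U qs) in
                 Σ[ s′ ∈ (X → Side) ] Consistent s′ × Branch s′ left L′ [] × Branch s′ right R′ []
  loop-correct {s} _ _ [] [] _ (consistent , bₗ , bᵣ , _) = s , consistent , bₗ , bᵣ
  -- Undecided points are still to be visited, so none is left at the end.
  loop-correct _ _ (_ ∷ _) [] _ (_ , _ , _ , U⊆ , _) with () ← U⊆ (here refl)
  loop-correct {choose = choose} L R U (q ∷ qs) (qs≺q ∷ descending) pending
    with s′ , pending′ ← decide-correct {choose = choose} qs≺q pending
    = loop-correct _ _ _ qs descending (scan-pending {s′} _ _ _ qs≺q pending′)

  -- The returned list.

  -- On the left `OrderFrom s` runs against `≺`, hence the reversal of `L`. Points on different
  -- sides are compared through `p`.
  assemble : ∀ {s L R} → Consistent s → Branch s left L [] → Branch s right R [] →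
             SortedAlongCompatibleOrder (reverse L ++ p ∷ R)
  assemble {s} {L} {R} consistent bₗ bᵣ =
    complete , OrderFrom s , consistent⇒compatible consistent ,
    AllPairs.++⁺ (AllPairs-reverse⁺ (inward (AllPairs.tail (chain bₗ)) (onSide bₗ)))
      (All.tabulate (λ y∈R → p<R y∈R) ∷ outward (AllPairs.tail (chain bᵣ)) (onSide bᵣ))
      (All.tabulate λ x∈ → L<p (reverse⁻ x∈) ∷ All.tabulate λ y∈R → <-trans (L<p (reverse⁻ x∈)) (p<R y∈R))
    where
    <-trans = IsStrictTotalOrder.trans (OrderFrom-isStrictTotalOrder s)

    complete : ∀ x → x ∈ reverse L ++ p ∷ R
    complete x with x ≟ p | side-cases (s x)
    ... | yes refl | _       = ∈-++⁺ʳ (reverse L) (here refl)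
    ... | no x≢p   | inj₁ xl = ∈-++⁺ˡ (reverse⁺ (cover bₗ x≢p xl))
    ... | no x≢p   | inj₂ xr = ∈-++⁺ʳ (reverse L) (there (cover bᵣ x≢p xr))

    L<p : ∀ {x} → x ∈ L → OrderFrom s x p
    L<p x∈L = inj₂ (p≺ bₗ x∈L , All.lookup (onSide bₗ) x∈L)

    p<R : ∀ {y} → y ∈ R → OrderFrom s p y
    p<R y∈R = inj₁ (p≺ bᵣ y∈R , All.lookup (onSide bᵣ) y∈R)

    inward : ∀ {K} → AllPairs _≺_ K → All (λ x → s x ≡ left) K → AllPairs (flip (OrderFrom s)) K
    inward []       []        = []
    inward (x≺ ∷ K) (_ ∷ Kl) = All.zipWith (λ (x≺y , yl) → inj₂ (x≺y , yl)) (x≺ , Kl) ∷ inward K Kl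

    outward : ∀ {K} → AllPairs _≺_ K → All (λ x → s x ≡ right) K → AllPairs (OrderFrom s) K
    outward []       []        = []
    outward (x≺ ∷ K) (_ ∷ Kr) = All.zipWith inj₁ (x≺ , Kr) ∷ outward K Kr

  sort-correct : ∀ {s choose xs} → Consistent s → ListsAllBut p _≺_ xs →
                 SortedAlongCompatibleOrder (value (sortByBipartition choose p xs))
  sort-correct {s} {choose} {xs} consistent (ascending , lists) = finish
    (loop-correct {s} {choose} [] [] (reverse xs) (reverse xs) (AllPairs-reverse⁺ ascending)
      (consistent , whole , whole , (λ x∈ → x∈) ,
       -- At the start `ws` holds every point but `p`, so the equidistance condition is vacuous.
       λ _ w≢p w∉ → contradiction (reverse⁺ (≢p⇒∈xs w≢p)) w∉))
    where
    ∈xs⇒≢p : ∀ {x} → x ∈ xs → x ≢ p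
    ∈xs⇒≢p = Equivalence.to (lists _)

    ≢p⇒∈xs : ∀ {x} → x ≢ p → x ∈ xs
    ≢p⇒∈xs = Equivalence.from (lists _)

    whole : ∀ {σ} → Branch s σ [] (reverse (reverse xs))
    whole {σ} = subst (Branch s σ []) (sym (reverse-involutive xs)) record
      { chain  = subst (AllPairs _≺_ ∘ (p ∷_)) (sym (++-identityʳ xs))
                   (All.tabulate (λ x∈xs → p-minimum _ (∈xs⇒≢p x∈xs)) ∷ ascending)
      ; onSide = []
      ; cover  = λ x≢p _ → ∈-++⁺ˡ (≢p⇒∈xs x≢p)
      }

    finish : ∀ {L R} → Σ[ s′ ∈ (X → Side) ] Consistent s′ × Branch s′ left L [] × Branch s′ right R [] →
             SortedAlongCompatibleOrder (reverse L ++ p ∷ R)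
    finish (_ , consistent′ , bₗ , bᵣ) = assemble consistent′ bₗ bᵣ

-- Running time.

true-or-false : ∀ b → b ≡ true ⊎ b ≡ false
true-or-false true  = inj₁ refl
true-or-false false = inj₂ refl

module Complexity
  {c ℓ₁ ℓ₂} (D : DecTotalOrder c ℓ₁ ℓ₂)
  {a} {X : Set a} (_≟_ : DecidableEquality X) (d : X → X → DecTotalOrder.Carrier D)
  (N : ℕ)
  where

  open DecTotalOrder D using () renaming (_≟_ to _≈?_)
  open Algorithm D _≟_ d
  open Unfolding D _≟_ d

  -- N bounds the number of points; each skipped or undecided point
  -- carries a credit of N + 9, spent when it is placed.
  ScanCost : ℕ → ℕ → Timed (List X × List X × List X) → Set
  ScanCost k u t = let (L , R , K) = value t in
    length L + (length R + length K) ≤ N ×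
    time t + (N + 9) * length K ≤ (N + 9) * (k + u) + (2 * u + 1)

  -- The membership tests walk along `L` and `R`, the concatenation along `K`. With nine unit
  -- charges this is at most `N + 9`, the credit of `x` itself.
  moveCost : ∀ {L R K : List X} {p q x u k′ t} → length L + (length R + (length K + suc u)) ≤ N →
             t + (N + 9) * k′ ≤ (N + 9) * (0 + u) + (2 * u + 1) →
             moveTime p q x L R K t + (N + 9) * k′ ≤ (N + 9) * (length K + suc u) + (2 * suc u + 1)
  moveCost {L} {R} {K} {u = u} {k′} {t} size rest = begin
    1 + (1 + (suc l + (1 + (suc r + 1))) + (1 + (suc k + (1 + t)))) + (N + 9) * k′
      ≡⟨ regroup l r k t ((N + 9) * k′) ⟩
    (l + (r + k) + 9) + (t + (N + 9) * k′)
      ≤⟨ +-mono-≤ (+-monoˡ-≤ 9 (≤-trans (+-monoʳ-≤ l (+-monoʳ-≤ r (m≤m+n k (suc u)))) size)) rest ⟩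
    (N + 9) + ((N + 9) * u + (2 * u + 1))
      -- The slack consists of the credits of the released points and the two units reserved for
      -- visiting `x`.
      ≤⟨ m≤m+n _ ((N + 9) * k + 2) ⟩
    (N + 9) + ((N + 9) * u + (2 * u + 1)) + ((N + 9) * k + 2)
      ≡⟨ collect N k u ⟩
    (N + 9) * (k + suc u) + (2 * suc u + 1) ∎
    where
    open ≤-Reasoning
    l = length L
    r = length R
    k = length K

    regroup : ∀ l r k t s → 1 + (1 + (suc l + (1 + (suc r + 1))) + (1 + (suc k + (1 + t)))) + s ≡
                            (l + (r + k) + 9) + (t + s)
    regroup = solve-∀

    collect : ∀ N k u → (N + 9) + ((N + 9) * u + (2 * u + 1)) + ((N + 9) * k + 2) ≡
                        (N + 9) * (k + suc u) + (2 * suc u + 1)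
    collect = solve-∀

  skip-size : ∀ l r k u → l + (r + (k + suc u)) ≡ l + (r + (suc k + u))
  skip-size = solve-∀

  left-size : ∀ l r (K : List X) {R} u → r ≡ length R →
              l + (r + (length K + suc u)) ≡ suc l + (length (K ++ R) + (0 + u))
  left-size l _ K {R} u refl = trans (arith l (length R) (length K) u)
    (cong (λ m → suc l + (m + u)) (sym (length-++ K)))
    where
    arith : ∀ l r k u → l + (r + (k + suc u)) ≡ suc l + ((k + r) + u)
    arith = solve-∀

  right-size : ∀ {L} r (K : List X) u →
               length L + (r + (length K + suc u)) ≡ length (K ++ L) + (suc r + (0 + u))
  right-size {L} r K u = trans (arith (length L) r (length K) u)
    (cong (_+ (suc r + u)) (sym (length-++ K)))
    where
    arith : ∀ l r k u → l + (r + (k + suc u)) ≡ (k + l) + (suc r + u)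
    arith = solve-∀

  -- A skipped point keeps its credit and costs two units, the comparison and the cons, which the
  -- term `2 * u` provides; a placed point is paid for by `moveCost`.
  scan-cost : ∀ p q L R K U → length L + (length R + (length K + length U)) ≤ N →
              ScanCost (length K) (length U) (scan p q L R K U)
  scan-cost p q L R K [] size = subst (λ k → length L + (length R + k) ≤ N) (+-identityʳ _) size ,
    ≤-reflexive (arith N (length K))
    where
    arith : ∀ N k → 1 + (N + 9) * k ≡ (N + 9) * (k + 0) + (0 + 1)
    arith = solve-∀
  scan-cost p q L R K (x ∷ U) size with true-or-false (does (d x q ≈? d p q))
  ... | inj₁ same
    with size′ , cost ← scan-cost p q L R (x ∷ K) U
           (subst (_≤ N) (skip-size (length L) (length R) (length K) (length U)) size)
    = subst (ScanCost (length K) (suc (length U))) (sym (scan-skip {L = L} {R} {K} {U} same))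
        (size′ , (begin
          2 + t + c′                                         ≡⟨ +-assoc 2 t c′ ⟩
          2 + (t + c′)                                       ≤⟨ +-monoʳ-≤ 2 cost ⟩
          2 + ((N + 9) * (suc k + u) + (2 * u + 1))          ≡⟨ arith N k u ⟩
          (N + 9) * (k + suc u) + (2 * suc u + 1)            ∎))
    where
    open ≤-Reasoning
    k = length K
    u = length U
    t = time (scan p q L R (x ∷ K) U)
    c′ = (N + 9) * length (proj₂ (proj₂ (value (scan p q L R (x ∷ K) U))))

    arith : ∀ N k u → 2 + ((N + 9) * (suc k + u) + (2 * u + 1)) ≡ (N + 9) * (k + suc u) + (2 * suc u + 1)
    arith = solve-∀
  ... | inj₂ differ with true-or-false (value (goesLeft p q x L R))
  ...   | inj₁ toLeft
    with size′ , cost ← scan-cost p q (x ∷ L) (K ++ R) [] U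
           (subst (_≤ N) (left-size (length L) (length R) K (length U) refl) size)
    = subst (ScanCost (length K) (suc (length U))) (sym (scan-left {L = L} {R} {K} {U} differ toLeft))
        (size′ , moveCost {L} {R} {K} {p} {q} {x} size cost)
  ...   | inj₂ toRight
    with size′ , cost ← scan-cost p q (K ++ L) (x ∷ R) [] U
           (subst (_≤ N) (right-size (length R) K (length U)) size)
    = subst (ScanCost (length K) (suc (length U))) (sym (scan-right {L = L} {R} {K} {U} differ toRight))
        (size′ , moveCost {L} {R} {K} {p} {q} {x} size cost)

  -- The bound `2 * u + 3` covers a membership test and a removal, `u + 1` steps each, and one cons.
  DecideCost : ℕ → Timed (List X × List X × List X) → Set
  DecideCost u t = let (L , R , U) = value t in
    length L + (length R + length U) ≤ N × length U ≤ u × time t ≤ 2 * u + 3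

  decide-cost : ∀ choose q L R U → length L + (length R + length U) ≤ N →
                DecideCost (length U) (decide choose q L R U)
  decide-cost choose q L R U size with DecMembership._∈?_ _≟_ q U
  ... | no _ = size , ≤-refl ,
    ≤-trans (m≤m+n (suc (length U) + 0) (length U + 2)) (≤-reflexive (arith (length U)))
    where
    arith : ∀ u → suc u + 0 + (u + 2) ≡ 2 * u + 3
    arith = solve-∀
  ... | yes q∈U = by-side (choose q)
    where
    U₁ = filter (λ y → ¬? (y ≟ q)) U

    shorter : length U₁ < length U
    shorter = filter-notAll (λ y → ¬? (y ≟ q)) U (Any.map (λ q≡y y≢q → y≢q (sym q≡y)) q∈U)

    smaller : length L + (length R + suc (length U₁)) ≤ N
    smaller = ≤-trans (+-monoʳ-≤ (length L) (+-monoʳ-≤ (length R) shorter)) size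

    in-left : ∀ l r u → suc l + (r + u) ≡ l + (r + suc u)
    in-left = solve-∀

    in-right : ∀ l r u → l + (suc r + u) ≡ l + (r + suc u)
    in-right = solve-∀

    arith : ∀ u → suc u + (1 + 0 + (suc u + 0)) ≡ 2 * u + 3
    arith = solve-∀

    by-side : ∀ σ → let (L₁ , R₁) = value (place σ q L R) in
              DecideCost (length U) ((L₁ , R₁ , U₁) after
                (suc (length U) + (time (place σ q L R) + (suc (length U) + 0))))
    by-side left  = ≤-trans (≤-reflexive (in-left (length L) (length R) (length U₁))) smaller ,
                    <⇒≤ shorter , ≤-reflexive (arith (length U))
    by-side right = ≤-trans (≤-reflexive (in-right (length L) (length R) (length U₁))) smaller ,
                    <⇒≤ shorter , ≤-reflexive (arith (length U))

  -- Beyond the credits a round costs at most `2 * N + 3` for deciding, `2 * N + 1` for scanning,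
  -- `1` for the empty list and `N + 1` for the reversal: `5 * N + 6` in all.
  round-cost : ∀ {u u₁ k m t₁ t₂ t₃} → u ≤ N → u₁ ≤ u → k ≤ N → t₁ ≤ 2 * u + 3 →
               t₂ + (N + 9) * k ≤ (N + 9) * (0 + u₁) + (2 * u₁ + 1) →
               t₃ ≤ (N + 9) * k + ((5 * N + 6) * m + 1) →
               t₁ + (1 + (t₂ + (suc k + t₃))) ≤ (N + 9) * u + ((5 * N + 6) * suc m + 1)
  round-cost {u} {u₁} {k} {m} {t₁} {t₂} {t₃} u≤N u₁≤u k≤N decided scanned rest = begin
    t₁ + (1 + (t₂ + (suc k + t₃)))
      ≤⟨ +-monoʳ-≤ t₁ (+-monoʳ-≤ 1 (+-monoʳ-≤ t₂ (+-mono-≤ (s≤s k≤N) rest))) ⟩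
    t₁ + (1 + (t₂ + (suc N + ((N + 9) * k + ((5 * N + 6) * m + 1)))))
      -- The credit needed by the later rounds is the one that the scan leaves on `K`.
      ≡⟨ regroup t₁ t₂ N ((N + 9) * k) ((5 * N + 6) * m + 1) ⟩
    t₁ + (t₂ + (N + 9) * k) + (N + 2 + ((5 * N + 6) * m + 1))
      ≤⟨ +-monoˡ-≤ _ (+-mono-≤ (≤-trans decided (+-monoˡ-≤ 3 (*-monoʳ-≤ 2 u≤N)))
           (≤-trans scanned (+-mono-≤ (*-monoʳ-≤ (N + 9) u₁≤u)
             (+-monoˡ-≤ 1 (*-monoʳ-≤ 2 (≤-trans u₁≤u u≤N)))))) ⟩
    2 * N + 3 + ((N + 9) * u + (2 * N + 1)) + (N + 2 + ((5 * N + 6) * m + 1))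
      ≡⟨ collect N u m ⟩
    (N + 9) * u + ((5 * N + 6) * suc m + 1) ∎
    where
    open ≤-Reasoning

    regroup : ∀ t₁ t₂ N c m → t₁ + (1 + (t₂ + (suc N + (c + m)))) ≡ t₁ + (t₂ + c) + (N + 2 + m)
    regroup = solve-∀

    collect : ∀ N u m → 2 * N + 3 + ((N + 9) * u + (2 * N + 1)) + (N + 2 + ((5 * N + 6) * m + 1)) ≡
                        (N + 9) * u + ((5 * N + 6) * suc m + 1)
    collect = solve-∀

  -- Every undecided point brings its credit and every point to be visited a budget of `5 * N + 6`;
  -- the invariant on the three lengths supplies the bounds by `N` within a round.
  loop-cost : ∀ choose p L R U qs → length L + (length R + length U) ≤ N →
              let (L′ , R′) = value (loop choose p L R U qs) in
              length L′ + length R′ ≤ N ×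
              time (loop choose p L R U qs) ≤ (N + 9) * length U + ((5 * N + 6) * length qs + 1)
  loop-cost choose p L R U [] size =
    ≤-trans (+-monoʳ-≤ (length L) (m≤m+n (length R) (length U))) size ,
    ≤-trans (m≤n+m 1 ((5 * N + 6) * 0)) (m≤n+m _ ((N + 9) * length U))
  loop-cost choose p L R U (q ∷ qs) size = proj₁ after-round ,
    (round-cost (≤-trans (m≤n+m _ (length R)) (≤-trans (m≤n+m _ (length L)) size)) U₁≤U K≤N decided scanned
        (subst (λ k → time (loop choose p L₂ R₂ (reverse K) qs) ≤ (N + 9) * k + ((5 * N + 6) * length qs + 1))
          (length-reverse K) (proj₂ after-round)))
    where
    decision = decide choose q L R U
    decideTime = time decision
    L₁ = proj₁ (value decision)
    R₁ = proj₁ (proj₂ (value decision))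
    U₁ = proj₂ (proj₂ (value decision))

    scanning = scan p q L₁ R₁ [] U₁
    scanTime = time scanning
    L₂ = proj₁ (value scanning)
    R₂ = proj₁ (proj₂ (value scanning))
    K  = proj₂ (proj₂ (value scanning))

    decide-bounds : DecideCost (length U) decision
    decide-bounds = decide-cost choose q L R U size

    U₁≤U = proj₁ (proj₂ decide-bounds)
    decided = proj₂ (proj₂ decide-bounds)

    scan-bounds : ScanCost 0 (length U₁) scanning
    scan-bounds = scan-cost p q L₁ R₁ [] U₁ (proj₁ decide-bounds)

    scanned = proj₂ scan-bounds

    K≤N : length K ≤ N
    K≤N = ≤-trans (m≤n+m _ (length R₂)) (≤-trans (m≤n+m _ (length L₂)) (proj₁ scan-bounds))

    after-round : let (L′ , R′) = value (loop choose p L₂ R₂ (reverse K) qs) in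
                  length L′ + length R′ ≤ N ×
                  time (loop choose p L₂ R₂ (reverse K) qs) ≤
                    (N + 9) * length (reverse K) + ((5 * N + 6) * length qs + 1)
    after-round = loop-cost choose p L₂ R₂ (reverse K) qs
      (subst (λ k → length L₂ + (length R₂ + k) ≤ N) (sym (length-reverse K)) (proj₁ scan-bounds))

module _
  {c ℓ₁ ℓ₂} (D : DecTotalOrder c ℓ₁ ℓ₂)
  {a} {X : Set a} (_≟_ : DecidableEquality X) (d : X → X → DecTotalOrder.Carrier D)
  where

  open Algorithm D _≟_ d

  -- The successor counts `p`, so that the square is that of the number of points.
  sort-cost : ∀ choose p xs → time (sortByBipartition choose p xs) ≤ 10 * suc (length xs) ^ 2
  sort-cost choose p xs = begin
    1 + (1 + (suc N + (suc N + (loopTime + (suc (length L) + (2 + suc (length (reverse L))))))))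
      ≡⟨ cong (λ l → 1 + (1 + (suc N + (suc N + (loopTime + (suc (length L) + (2 + suc l))))))) (length-reverse L) ⟩
    1 + (1 + (suc N + (suc N + (loopTime + (suc (length L) + (2 + suc (length L)))))))
      ≡⟨ regroup N loopTime (length L) ⟩
    loopTime + 2 * length L + (2 * N + 8)
      ≤⟨ +-monoˡ-≤ (2 * N + 8) (+-mono-≤ looped (*-monoʳ-≤ 2 (≤-trans (m≤m+n (length L) (length R)) L+R≤N))) ⟩
    ((N + 9) * N + ((5 * N + 6) * N + 1)) + 2 * N + (2 * N + 8)
      -- The total so far is 6N² + 19N + 9; the added terms complete it to 10(N + 1)².
      ≤⟨ m≤m+n _ (4 * (N * N) + N + 1) ⟩
    ((N + 9) * N + ((5 * N + 6) * N + 1)) + 2 * N + (2 * N + 8) + (4 * (N * N) + N + 1)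
      ≡⟨ collect N ⟩
    10 * (suc N * (suc N * 1)) ∎
    where
    open ≤-Reasoning
    N = length xs
    looping = loop choose p [] [] (reverse xs) (reverse xs)
    loopTime = time looping
    L = proj₁ (value looping)
    R = proj₂ (value looping)

    loop-bounds : length L + length R ≤ N ×
                  loopTime ≤ (N + 9) * length (reverse xs) + ((5 * N + 6) * length (reverse xs) + 1)
    loop-bounds = Complexity.loop-cost D _≟_ d N choose p [] [] (reverse xs) (reverse xs)
      (≤-reflexive (length-reverse xs))

    L+R≤N = proj₁ loop-bounds

    looped : loopTime ≤ (N + 9) * N + ((5 * N + 6) * N + 1)
    looped = subst (λ m → loopTime ≤ (N + 9) * m + ((5 * N + 6) * m + 1)) (length-reverse xs) (proj₂ loop-bounds)

    regroup : ∀ N t l → 1 + (1 + (suc N + (suc N + (t + (suc l + (2 + suc l)))))) ≡ t + 2 * l + (2 * N + 8)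
    regroup = solve-∀

    collect : ∀ N → ((N + 9) * N + ((5 * N + 6) * N + 1)) + 2 * N + (2 * N + 8) + (4 * (N * N) + N + 1) ≡
                    10 * (suc N * (suc N * 1))
    collect = solve-∀

-- Counting the points, and the theorem.

Unique⇒length≤ : ∀ {n} {xs : List A} → A ↔ Fin n → Unique xs → length xs ≤ n
Unique⇒length≤ A↔Fin xs! = injective⇒≤ (lookup-injective xs! ∘ Injection.injective (↔⇒↣ A↔Fin))

proposition6p15 :
  ∀ {c ℓ₁ ℓ₂ a : Level} →
  Σ[ C ∈ ℕ ]
    ((D : DecTotalOrder c ℓ₁ ℓ₂) (0# : DecTotalOrder.Carrier D)
     (X : Set a) (n : ℕ) (X↔Fin : X ↔ Fin n)
     (d : X → X → DecTotalOrder.Carrier D) →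
     let open Robinson D 0# d
         open Algorithm D (finite⇒≟ X↔Fin) d
     in
     IsRobinsonSpace →
     (p : X) (_≺_ : Rel X 0ℓ) → IsProximityOrder p _≺_ →
     (xs : List X) → ListsAllBut p _≺_ xs →
     (choose : X → Side) →
     SortedAlongCompatibleOrder (value (sortByBipartition choose p xs)) ×
     time (sortByBipartition choose p xs) ≤ C * n ^ 2)
proposition6p15 = 10 , λ D 0# X n X↔Fin d robinson p _≺_ (_<_ , <-compatible , ≺-proximity) xs lists choose →
  let open Robinson D 0# d
      open IsRobinsonSpace robinson using (isDissimilarity)
      open IsProximityOrderFor ≺-proximity using (isStrictTotalOrder) renaming (minimum to p-minimum)
      module ≺ = IsStrictTotalOrder isStrictTotalOrder
      open Correctness D 0# (finite⇒≟ X↔Fin) d (IsDissimilarity.symmetric isDissimilarity)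
        isStrictTotalOrder p p-minimum
      (_ , consistent) = proximity⇒consistent <-compatible ≺-proximity
      (ascending , members) = lists
      -- Putting `p` in front of `xs` gives a list without repetitions, whence `suc (length xs)` is
      -- at most `n`.
      p≢xs = All.tabulate λ x∈xs p≡x → Equivalence.to (members _) x∈xs (sym p≡x)
      distinct = AllPairs.map (λ x≺y x≡y → ≺.irrefl x≡y x≺y) ascending
  in
  sort-correct consistent lists ,
  ≤-trans (sort-cost D (finite⇒≟ X↔Fin) d choose p xs)
    (*-monoʳ-≤ 10 (^-monoˡ-≤ 2 (Unique⇒length≤ X↔Fin (p≢xs ∷ distinct))))
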